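{- Let $\mathcal{K}$ be a finite class of similar finite smooth idempotent algebras with the fixed operation $\cdot$, let $\mathbb{A}\in\mathcal{K}$, let $ab$ be a semilattice edge of $\mathbb{A}$, $\theta$ a congruence of $\mathsf{Sg}\{a,b\}$ that witnesses this, with $ab$ oriented from $a$ to $b$ (that is, $a/\theta\cdot b/\theta=b/\theta\cdot a/\theta=b/\theta$), and let $c\in a/\theta$. Then there is $d\in b/\theta$ such that $cd$ is a thin semilattice edge. Moreover, $cd$ is a thin semilattice edge for every $d\in b/\theta$ such that $cd$ is minimal with respect to (the restriction to $\mathsf{Sg}\{c,d\}$ of) $\theta$.
   Context: $\mathsf{Sg}\{a,b\}$ is the subalgebra generated by $a,b$. For a congruence $\theta$ of $\mathsf{Sg}\{a,b\}$, $a/\theta$ is the $\theta$-block of $a$ and $f/\theta$ the operation induced by $f$ on the quotient. An algebra is called a set if all its term operations are projections; it is called a module if it is term equivalent to the full idempotent reduct of a module over a ring (the reduct whose operations are all idempotent term operations of that module), with affine operation $x-y+z$. Edges: a pair $ab$ of distinct elements of an idempotent algebra $\mathbb{A}$ is a semilattice edge witnessed by a congruence $\theta$ of $\mathsf{Sg}\{a,b\}$ with $a/\theta\ne b/\theta$ if some binary term operation induces a semilattice operation on $\{a/\theta,b/\theta\}$; a majority edge witnessed by $\theta$ if some ternary term operation induces a majority operation on $\{a/\theta,b/\theta\}$ but no term operation induces a semilattice operation there; an affine edge witnessed by $\theta$ if $\mathsf{Sg}\{a,b\}/\theta$ is a module and some term operation induces its operation $x-y+z$. In each case $\{a/\theta,b/\theta\}$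 is a thick edge of that type. An idempotent algebra is smooth if for every thick edge $\{a/\theta,b/\theta\}$ of semilattice or majority type the set $a/\theta\cup b/\theta$ is a subuniverse. A thin semilattice edge is a semilattice edge whose semilattice type is witnessed by the equality relation. $\cdot$ denotes a fixed binary term operation of $\mathcal{K}$ that is a semilattice operation on every thick semilattice edge of every algebra in $\mathcal{K}$, is the first projection on every thick majority or affine edge, satisfies $x\cdot(x\cdot y)=x\cdot y$, and satisfies the SLS condition: for any $a,b\in\mathbb{A}\in\mathcal{K}$, either $a\cdot b=a$ or $(a,a\cdot b)$ is a thin semilattice edge. (Such an operation exists.) A pair $ab$ is minimal with respect to a congruence $\theta$ of $\mathsf{Sg}\{a,b\}$ if for any $b'\in b/\theta$ we have $b\in\mathsf{Sg}\{a,b'\}$. For $c\in a/\theta$, $d\in b/\theta$, minimality of $cd$ is with respect to the restriction of $\theta$ to $\mathsf{Sg}\{c,d\}$. -}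

module Defs where

open import Level using (0ℓ)
open import Algebra.Bundles using (Ring)
open import Algebra.Core using (Op₁; Op₂)
open import Algebra.Lattice.Structures using (IsSemilattice)
open import Algebra.Module.Core using (Opₗ)
open import Algebra.Module.Structures using (IsLeftModule)
open import Data.Fin.Base using (Fin; zero; suc)
open import Data.Nat.Base using (ℕ; suc)
open import Data.Product.Base using (Σ; Σ-syntax; ∃; ∃-syntax; _×_; _,_; proj₁; proj₂)
open import Data.Sum.Base using (_⊎_; inj₁; inj₂)
open import Data.Vec.Functional using (Vector; []; _∷_; replicate)
open import Function.Base using (_∘_; _on_)
open import Function.Bundles using (Inverse)
open import Relation.Binary.Bundles using (Setoid)
open import Relation.Binary.Core using (Rel)
open import Relation.Binary.PropositionalEquality using (setoid)
open import Relation.Binary.Structures using (IsEquivalence)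
import Relation.Binary.Construct.On as On
open import Relation.Nullary.Negation using (¬_)
open import Relation.Unary using (Pred; _∈_; _⊆_)

------------------------------------------------------------------------
-- Algebras.  The carrier is a setoid, so that a quotient A/θ is an
-- algebra with the elements of A and with θ as its equality.

record Signature : Set₁ where
  field
    Op    : Set
    arity : Op → ℕ

open Signature public

record Structure (S : Signature) (X : Setoid 0ℓ 0ℓ) : Set where
  open Setoid X
  field
    op      : (f : Op S) → Vector Carrier (arity S f) → Carrier
    op-cong : ∀ f {xs ys} → (∀ i → xs i ≈ ys i) → op f xs ≈ op f ys

record Algebra (S : Signature) : Set₁ where
  field
    universe  : Setoid 0ℓ 0ℓ
    structure : Structure S universe

  open Setoid universe public
  open Structure structure public

IsFinite : ∀ {S} → Algebra S → Set
IsFinite A = ∃[ n ] Inverse (Algebra.universe A) (setoid (Fin n))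

IsIdempotent : ∀ {S} → Algebra S → Set
IsIdempotent A = ∀ f x → op f (replicate _ x) ≈ x
  where open Algebra A

data Term (S : Signature) (n : ℕ) : Set where
  var : Fin n → Term S n
  app : (f : Op S) → Vector (Term S n) (arity S f) → Term S n

module _ {S : Signature} (A : Algebra S) where
  open Algebra A

  eval : ∀ {n} → Term S n → Vector Carrier n → Carrier
  eval (var i)    ρ = ρ i
  eval (app f ts) ρ = op f (λ i → eval (ts i) ρ)

  eval-cong : ∀ {n} (t : Term S n) {ρ σ : Vector Carrier n} →
              (∀ i → ρ i ≈ σ i) → eval t ρ ≈ eval t σ
  eval-cong (var i)    e = e i
  eval-cong (app f ts) e = op-cong f (λ i → eval-cong (ts i) e)

  eval₂ : Term S 2 → Op₂ Carrier
  eval₂ t x y = eval t (x ∷ y ∷ [])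

  eval₃ : Term S 3 → Carrier → Carrier → Carrier → Carrier
  eval₃ t x y z = eval t (x ∷ y ∷ z ∷ [])

------------------------------------------------------------------------
-- Subuniverses and generated subalgebras

  IsSubuniverse : Pred Carrier 0ℓ → Set
  IsSubuniverse P = ∀ f xs → (∀ i → xs i ∈ P) → op f xs ∈ P

  pair : Carrier → Carrier → Pred Carrier 0ℓ
  pair a b x = x ≈ a ⊎ x ≈ b

  data Generated (G : Pred Carrier 0ℓ) : Pred Carrier 0ℓ where
    gen : ∀ {x} → x ∈ G → x ∈ Generated G
    app : ∀ {x} f xs → (∀ i → xs i ∈ Generated G) → x ≈ op f xs → x ∈ Generated G

  Generated-least : ∀ {G H} → G ⊆ Generated H → Generated G ⊆ Generated H
  Generated-least s (gen g)         = s g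
  Generated-least s (app f xs ps e) = app f xs (λ i → Generated-least s (ps i)) e

  Generated-resp : ∀ {a b x y} → x ≈ y → x ∈ Generated (pair a b) → y ∈ Generated (pair a b)
  Generated-resp e (gen (inj₁ p))   = gen (inj₁ (trans (sym e) p))
  Generated-resp e (gen (inj₂ p))   = gen (inj₂ (trans (sym e) p))
  Generated-resp e (app f xs ps e′) = app f xs ps (trans (sym e) e′)

  Sg : Carrier → Carrier → Algebra S
  Sg a b = record
    { universe  = record
      { Carrier       = Σ Carrier (Generated (pair a b))
      ; _≈_           = _≈_ on proj₁
      ; isEquivalence = On.isEquivalence proj₁ isEquivalence
      }
    ; structure = record
      { op      = λ f xs → op f (proj₁ ∘ xs) , app f (proj₁ ∘ xs) (proj₂ ∘ xs) refl
      ; op-cong = λ f e → op-cong f e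
      }
    }

  left : ∀ a b → Algebra.Carrier (Sg a b)
  left a b = a , gen (inj₁ refl)

  right : ∀ a b → Algebra.Carrier (Sg a b)
  right a b = b , gen (inj₂ refl)

  Sg-embed : ∀ {a b} (c d : Algebra.Carrier (Sg a b)) →
             Algebra.Carrier (Sg (proj₁ c) (proj₁ d)) → Algebra.Carrier (Sg a b)
  Sg-embed {a} {b} (_ , p) (_ , q) (x , r) = x , Generated-least incl r
    where
    incl : pair _ _ ⊆ Generated (pair a b)
    incl (inj₁ e) = Generated-resp (sym e) p
    incl (inj₂ e) = Generated-resp (sym e) q

------------------------------------------------------------------------
-- Congruences and quotients

record Congruence {S : Signature} (A : Algebra S) : Set₁ where
  open Algebra A
  field
    rel           : Rel Carrier 0ℓ
    isEquivalence : IsEquivalence rel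
    reflexive-≈   : ∀ {x y} → x ≈ y → rel x y
    compatible    : ∀ f {xs ys} → (∀ i → rel (xs i) (ys i)) → rel (op f xs) (op f ys)

open Congruence public using (rel)

module _ {S : Signature} where

  infixl 7 _/_

  _/_ : (A : Algebra S) → Congruence A → Algebra S
  A / θ = record
    { universe  = record
      { Carrier       = Algebra.Carrier A
      ; _≈_           = rel θ
      ; isEquivalence = Congruence.isEquivalence θ
      }
    ; structure = record
      { op      = Algebra.op A
      ; op-cong = Congruence.compatible θ
      }
    }

  equality : (A : Algebra S) → Congruence A
  equality A = record
    { rel           = _≈_
    ; isEquivalence = isEquivalence
    ; reflexive-≈   = λ e → e
    ; compatible    = op-cong
    } where open Algebra A

  restrict : (A : Algebra S) {a b : Algebra.Carrier A} → Congruence (Sg A a b) →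
             (c d : Algebra.Carrier (Sg A a b)) → Congruence (Sg A (proj₁ c) (proj₁ d))
  restrict A θ c d = record
    { rel           = rel θ on embed
    ; isEquivalence = On.isEquivalence embed θ.isEquivalence
    ; reflexive-≈   = θ.reflexive-≈
    ; compatible    = λ f {xs} {ys} e →
        θ.trans (θ.reflexive-≈ refl)
          (θ.trans (θ.compatible f {embed ∘ xs} {embed ∘ ys} e) (θ.reflexive-≈ refl))
    }
    where
    open Algebra A using (refl)
    module θ where
      open Congruence θ public
      open IsEquivalence (Congruence.isEquivalence θ) public using (trans)
    embed = Sg-embed A c d

------------------------------------------------------------------------
-- Term equivalence and modules

-- Term operations are taken to have positive arity.

module _ {S T : Signature} {X : Setoid 0ℓ 0ℓ} where
  open Setoid X

  TermOperationsOf_AreTermOperationsOf_ : Structure S X → Structure T X → Set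
  TermOperationsOf 𝐀 AreTermOperationsOf 𝐁 =
    ∀ {n} (s : Term S (suc n)) → ∃[ t ] ∀ (ρ : Vector Carrier (suc n)) →
      eval (record { structure = 𝐀 }) s ρ ≈ eval (record { structure = 𝐁 }) t ρ

TermEquivalent : ∀ {S T X} → Structure S X → Structure T X → Set
TermEquivalent 𝐀 𝐁 = TermOperationsOf 𝐀 AreTermOperationsOf 𝐁
                   × TermOperationsOf 𝐁 AreTermOperationsOf 𝐀

module _ {S : Signature} (A : Algebra S) where
  open Algebra A

  IdempotentTerm : ℕ → Set
  IdempotentTerm n = Σ[ t ∈ Term S (suc n) ] ∀ x → eval A t (replicate _ x) ≈ x

  idempotentReduct : Structure (record { Op = ∃ IdempotentTerm ; arity = suc ∘ proj₁ }) universe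
  idempotentReduct = record
    { op      = λ (_ , t , _) → eval A t
    ; op-cong = λ (_ , t , _) → eval-cong A t
    }

record ModuleOn (X : Setoid 0ℓ 0ℓ) : Set₁ where
  open Setoid X
  field
    ring         : Ring 0ℓ 0ℓ
    _+ᴹ_         : Op₂ Carrier
    0ᴹ           : Carrier
    -ᴹ_          : Op₁ Carrier
    _*ₗ_         : Opₗ (Ring.Carrier ring) Carrier
    isLeftModule : IsLeftModule ring _≈_ _+ᴹ_ 0ᴹ -ᴹ_ _*ₗ_

data ModuleOp (R : Set) : Set where
  plus null minus : ModuleOp R
  scale           : R → ModuleOp R

moduleSignature : Set → Signature
moduleSignature R = record
  { Op    = ModuleOp R
  ; arity = λ { plus → 2 ; null → 0 ; minus → 1 ; (scale _) → 1 }
  }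

moduleAlgebra : ∀ {X} (M : ModuleOn X) → Algebra (moduleSignature (Ring.Carrier (ModuleOn.ring M)))
moduleAlgebra {X} M = record
  { universe  = X
  ; structure = record
    { op      = λ { plus      xs → xs zero +ᴹ xs (suc zero)
                  ; null      xs → 0ᴹ
                  ; minus     xs → -ᴹ xs zero
                  ; (scale r) xs → r *ₗ xs zero
                  }
    ; op-cong = λ { plus      e → +ᴹ-cong (e zero) (e (suc zero))
                  ; null      e → Setoid.refl X
                  ; minus     e → -ᴹ‿cong (e zero)
                  ; (scale r) e → *ₗ-cong (Ring.refl ring) (e zero)
                  }
    }
  }
  where
  open ModuleOn M
  open IsLeftModule isLeftModule

record IsModule {S : Signature} (A : Algebra S) : Set₁ where
  open Algebra A
  field
    moduleOn       : ModuleOn universe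
    termEquivalent : TermEquivalent structure (idempotentReduct (moduleAlgebra moduleOn))

  open ModuleOn moduleOn

  affineOperation : Carrier → Carrier → Carrier → Carrier
  affineOperation x y z = (x +ᴹ (-ᴹ y)) +ᴹ z

------------------------------------------------------------------------
-- Edges

module _ {S : Signature} (A : Algebra S) (P : Pred (Algebra.Carrier A) 0ℓ) where
  open Algebra A

  IsSemilatticeOn : Op₂ Carrier → Set
  IsSemilatticeOn _∙_ =
    Σ[ closed ∈ (∀ {x y} → x ∈ P → y ∈ P → (x ∙ y) ∈ P) ]
      IsSemilattice {A = Σ Carrier P} (_≈_ on proj₁)
        (λ (x , p) (y , q) → x ∙ y , closed p q)

  -- On a two-element P every triple has a repeated entry, so these
  -- identities already make P closed under m.

  IsMajorityOn : (Carrier → Carrier → Carrier → Carrier) → Set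
  IsMajorityOn m = ∀ {x y} → x ∈ P → y ∈ P →
    m x x y ≈ x × m x y x ≈ x × m y x x ≈ x

  IsFirstProjectionOn : Op₂ Carrier → Set
  IsFirstProjectionOn _∙_ = ∀ {x y} → x ∈ P → y ∈ P → (x ∙ y) ≈ x

module _ {S : Signature} (A : Algebra S) (a b : Algebra.Carrier A)
         (θ : Congruence (Sg A a b)) where
  open Algebra A using (Carrier)

  private
    Q = Sg A a b / θ

  Thick : Pred (Algebra.Carrier Q) 0ℓ
  Thick = pair Q (left A a b) (right A a b)

  Separates : Set
  Separates = ¬ rel θ (left A a b) (right A a b)

  -- The three relations below say that ab is an edge of the given type
  -- witnessed by θ.  That a and b are distinct follows from Separates.

  SemilatticeEdge : Set
  SemilatticeEdge = Separates × ∃[ t ] IsSemilatticeOn Q Thick (eval₂ Q t)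

  MajorityEdge : Set
  MajorityEdge = Separates
               × (∃[ t ] IsMajorityOn Q Thick (eval₃ Q t))
               × ¬ (∃[ t ] IsSemilatticeOn Q Thick (eval₂ Q t))

  AffineEdge : Set₁
  AffineEdge = Separates
             × (Σ[ M ∈ IsModule Q ] ∃[ t ] ∀ x y z →
                  Algebra._≈_ Q (eval₃ Q t x y z) (IsModule.affineOperation M x y z))

  -- The set a/θ ∪ b/θ, as a subset of A.

  Blocks : Pred Carrier 0ℓ
  Blocks x = Σ[ p ∈ Generated A (pair A a b) x ] (x , p) ∈ Thick

  Minimal : Set
  Minimal = ∀ b′ → rel θ b′ (right A a b) → b ∈ Generated A (pair A a (proj₁ b′))

module _ {S : Signature} (A : Algebra S) where
  open Algebra A

  IsSmooth : Set₁
  IsSmooth = ∀ a b (θ : Congruence (Sg A a b)) →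
    SemilatticeEdge A a b θ ⊎ MajorityEdge A a b θ → IsSubuniverse A (Blocks A a b θ)

  ThinSemilatticeEdge : Carrier → Carrier → Set
  ThinSemilatticeEdge a b = SemilatticeEdge A a b (equality (Sg A a b))

-- The conditions on the fixed binary term operation of a class.

record IsFixedOperation {S : Signature} {I : Set} (K : I → Algebra S) (t : Term S 2) : Set₁ where
  field
    semilattice : ∀ i a b θ → SemilatticeEdge (K i) a b θ →
      IsSemilatticeOn (Sg (K i) a b / θ) (Thick (K i) a b θ) (eval₂ (Sg (K i) a b / θ) t)
    projection  : ∀ i a b θ → MajorityEdge (K i) a b θ ⊎ AffineEdge (K i) a b θ →
      IsFirstProjectionOn (Sg (K i) a b / θ) (Thick (K i) a b θ) (eval₂ (Sg (K i) a b / θ) t)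
    absorption  : ∀ i (let open Algebra (K i); _·_ = eval₂ (K i) t) →
      ∀ x y → (x · (x · y)) ≈ (x · y)
    SLS         : ∀ i (let open Algebra (K i); _·_ = eval₂ (K i) t) →
      ∀ a b → (a · b) ≈ a ⊎ ThinSemilatticeEdge (K i) a (a · b)

{-# OPTIONS --safe #-}

-- By SLS, c · x is either c or the end of a thin semilattice edge from c, and
-- the first case is excluded when x ∈ b/θ because then c · x ∈ b/θ.  Taking
-- x = b gives a thin edge.  If cd is minimal, then d ∈ Sg{c, c · d}, and by
-- smoothness of the thin edge (c, c · d) the latter is just {c, c · d}; as
-- d ∉ a/θ, we get d = c · d.

module Submission where

open import Defs
open import Level using (0ℓ)
open import Algebra.Bundles using (RawMagma)
open import Algebra.Morphism.Structures using (module MagmaMorphisms)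
import Algebra.Morphism.MagmaMonomorphism as MagmaMonomorphism
open import Algebra.Structures using (IsCommutativeBand)
open import Data.Nat.Base using (ℕ)
open import Data.Fin.Base using (Fin; zero; suc)
open import Data.Product.Base using (Σ; _×_; ∃-syntax; _,_; proj₁; proj₂)
open import Data.Sum.Base using (inj₁; inj₂)
open import Data.Vec.Functional using (Vector; []; _∷_)
open import Function.Base using (_∘_; _on_; case_of_)
import Relation.Binary.Reasoning.Setoid as SetoidReasoning
open import Relation.Nullary.Negation using (¬_; contradiction)
open import Relation.Unary using (Pred; _∈_; _⊆_)

module _ {S : Signature} (A : Algebra S) where
  open Algebra A

  Generated⊆ : ∀ {G P : Pred Carrier 0ℓ} → G ⊆ P → IsSubuniverse A P →
               (∀ {x y} → x ≈ y → x ∈ P → y ∈ P) → Generated A G ⊆ P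
  Generated⊆ G⊆P sub resp (gen g)         = G⊆P g
  Generated⊆ G⊆P sub resp (app f xs ps e) =
    resp (sym e) (sub f xs (λ i → Generated⊆ G⊆P sub resp (ps i)))

  module _ {a b : Carrier} (θ : Congruence (Sg A a b)) where

    -- Forming `Sg A a b` only attaches membership proofs and forming the quotient only coarsens
    -- equality. Hence the underlying values agree up to `≈` of `A`, not merely modulo `θ`.
    proj₁-eval : ∀ {n} (t : Term S n) (ρ : Vector (Algebra.Carrier (Sg A a b)) n) →
                 proj₁ (eval (Sg A a b / θ) t ρ) ≈ eval A t (proj₁ ∘ ρ)
    proj₁-eval (var i)    ρ = refl
    proj₁-eval (app f ts) ρ = op-cong f (λ i → proj₁-eval (ts i) ρ)

    proj₁-eval₂ : ∀ (t : Term S 2) x y →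
                  proj₁ (eval₂ (Sg A a b / θ) t x y) ≈ eval₂ A t (proj₁ x) (proj₁ y)
    proj₁-eval₂ t x y = trans (proj₁-eval t (x ∷ y ∷ []))
      -- `proj₁ ∘ (x ∷ y ∷ [])` and `proj₁ x ∷ proj₁ y ∷ []` are functions that agree pointwise, not
      -- definitionally.
      (eval-cong A t λ { zero → refl ; (suc zero) → refl })

  eval₂-cong : ∀ (t : Term S 2) {x x′ y y′} → x ≈ x′ → y ≈ y′ →
               eval₂ A t x y ≈ eval₂ A t x′ y′
  eval₂-cong t e e′ = eval-cong A t λ { zero → e ; (suc zero) → e′ }

  -- The two edges live in different generated subalgebras, so the semilattice
  -- structure is transported along a bijection of their two-element blocks.
  thinSemilatticeEdge-respʳ : ∀ {a b b′} → b ≈ b′ →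
    ThinSemilatticeEdge A a b → ThinSemilatticeEdge A a b′
  thinSemilatticeEdge-respʳ {a} {b} {b′} b≈b′ (a≉b , t , closed , semilattice) =
    (λ a≈b′ → a≉b (trans a≈b′ (sym b≈b′))) , t , closed′ , record
      { isBand = Mono.isBand isBand
      ; comm   = Mono.comm isMagma comm
      }
    where
    open IsCommutativeBand semilattice using (isBand; isMagma; comm)

    Edge : Carrier → Algebra S
    Edge y = Sg A a y / equality (Sg A a y)

    Block : Carrier → Set
    Block y = Σ (Algebra.Carrier (Edge y)) (Thick A a y (equality (Sg A a y)))

    -- The tag `inj₁` or `inj₂` alone shows membership in the other subalgebra, so the given
    -- generation proof is replaced by a fresh one.
    move : Block b′ → Block b
    move ((x , _) , inj₁ e) = (x , gen (inj₁ e)) , inj₁ e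
    move ((x , _) , inj₂ e) = (x , gen (inj₂ e′)) , inj₂ e′
      where e′ = trans e (sym b≈b′)

    value : ∀ {y} → Block y → Carrier
    value = proj₁ ∘ proj₁

    value-move : ∀ x → value (move x) ≈ value x
    value-move (_ , inj₁ _) = refl
    value-move (_ , inj₂ _) = refl

    homo : ∀ x y → proj₁ (eval₂ (Edge b) t (proj₁ (move x)) (proj₁ (move y))) ≈
                   proj₁ (eval₂ (Edge b′) t (proj₁ x) (proj₁ y))
    homo x y = begin
      proj₁ (eval₂ (Edge b) t (proj₁ (move x)) (proj₁ (move y)))
        ≈⟨ proj₁-eval₂ (equality (Sg A a b)) t (proj₁ (move x)) (proj₁ (move y)) ⟩
      eval₂ A t (value (move x)) (value (move y))
        ≈⟨ eval₂-cong t (value-move x) (value-move y) ⟩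
      eval₂ A t (value x) (value y)
        ≈⟨ proj₁-eval₂ (equality (Sg A a b′)) t (proj₁ x) (proj₁ y) ⟨
      proj₁ (eval₂ (Edge b′) t (proj₁ x) (proj₁ y)) ∎
      where open SetoidReasoning universe

    closed′ : ∀ {x y} → x ∈ Thick A a b′ (equality (Sg A a b′)) →
              y ∈ Thick A a b′ (equality (Sg A a b′)) →
              eval₂ (Edge b′) t x y ∈ Thick A a b′ (equality (Sg A a b′))
    closed′ {x} {y} p q
      -- Closure is transported by hand: the operation of `source` cannot be formed without it.
      with closed (proj₂ (move (x , p))) (proj₂ (move (y , q)))
    ... | inj₁ e = inj₁ (trans (sym (homo (x , p) (y , q))) e)
    ... | inj₂ e = inj₂ (trans (sym (homo (x , p) (y , q))) (trans e b≈b′))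

    source target : RawMagma 0ℓ 0ℓ
    source = record
      { Carrier = Block b′ ; _≈_ = _≈_ on value
      ; _∙_ = λ (x , p) (y , q) → eval₂ (Edge b′) t x y , closed′ p q }
    target = record
      { Carrier = Block b ; _≈_ = _≈_ on value
      ; _∙_ = λ (x , p) (y , q) → eval₂ (Edge b) t x y , closed p q }

    open MagmaMorphisms source target using (IsMagmaMonomorphism)

    -- An injective homomorphism reflects identities, so the semilattice laws pull back from the
    -- block at `b` to the block at `b′`.
    move-isMagmaMonomorphism : IsMagmaMonomorphism move
    move-isMagmaMonomorphism = record
      { isMagmaHomomorphism = record
        { isRelHomomorphism = record
          { cong = λ {x} {y} e → trans (value-move x) (trans e (sym (value-move y))) }
        ; homo = λ x y → trans (value-move (RawMagma._∙_ source x y)) (sym (homo x y))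
        }
      ; injective = λ {x} {y} e → trans (sym (value-move x)) (trans e (value-move y))
      }

    module Mono = MagmaMonomorphism move-isMagmaMonomorphism

  -- The blocks of the equality relation are singletons, so smoothness makes the two endpoints alone
  -- a subuniverse.
  thin⇒Sg⊆pair : IsSmooth A → ∀ {a b} → ThinSemilatticeEdge A a b →
                 Generated A (pair A a b) ⊆ pair A a b
  thin⇒Sg⊆pair smooth {a} {b} thin =
    proj₂ ∘ Generated⊆ (λ p → gen p , p) (smooth a b (equality (Sg A a b)) (inj₁ thin))
      (λ { e (p , inj₁ q) → Generated-resp A e p , inj₁ (trans (sym e) q)
         ; e (p , inj₂ q) → Generated-resp A e p , inj₂ (trans (sym e) q) })

corollary4p3 : ∀ {S : Signature} {m : ℕ} (K : Fin m → Algebra S) →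
    (∀ i → IsFinite (K i)) →
    (∀ i → IsIdempotent (K i)) →
    (∀ i → IsSmooth (K i)) →
    (t : Term S 2) → IsFixedOperation K t →
    ∀ (i : Fin m) (let A = K i) (a b : Algebra.Carrier A) (θ : Congruence (Sg A a b)) →
    (let Q   = Sg A a b / θ
         a/θ = left A a b
         b/θ = right A a b
         open Algebra Q using (_≈_)
         _·_ = eval₂ Q t) →
    SemilatticeEdge A a b θ →
    (a/θ · b/θ) ≈ b/θ →
    (b/θ · a/θ) ≈ b/θ →
    (c : Algebra.Carrier Q) → c ≈ a/θ →
    (∃[ d ] (d ≈ b/θ × ThinSemilatticeEdge A (proj₁ c) (proj₁ d)))
    × (∀ (d : Algebra.Carrier Q) → d ≈ b/θ →
         Minimal A (proj₁ c) (proj₁ d) (restrict A θ c d) →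
         ThinSemilatticeEdge A (proj₁ c) (proj₁ d))
corollary4p3 K _ _ smooth t fixed i a b θ (a≉b , _) ab≈b _ c c≈a =
  ( (c · right A a b , c·-in-b/θ Q.refl
    -- The witness is a product in the quotient, which carries its membership in `Sg A a b`; SLS
    -- concerns the product in `A`. The two are only `≈`-equal.
    , thinSemilatticeEdge-respʳ A (sym (proj₁-eval₂ A θ t c (right A a b))) (thin-c-c· Q.refl))
  , minimal⇒thin )
  where
  A = K i
  open Algebra A using (_≈_; refl; sym; trans)
  module Q = Algebra (Sg A a b / θ)
  open Congruence θ using (reflexive-≈)

  _·_ = eval₂ (Sg A a b / θ) t
  _·ᴬ_ = eval₂ A t

  c≉b/θ : ∀ {d} → d Q.≈ right A a b → ¬ (proj₁ c ≈ proj₁ d)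
  c≉b/θ d≈b c≈d = a≉b (Q.trans (Q.sym c≈a) (Q.trans (reflexive-≈ c≈d) d≈b))

  -- Modulo `θ` the product is `a/θ · b/θ`.
  c·-in-b/θ : ∀ {d} → d Q.≈ right A a b → (c · d) Q.≈ right A a b
  c·-in-b/θ d≈b = Q.trans (eval₂-cong (Sg A a b / θ) t c≈a d≈b) ab≈b

  thin-c-c· : ∀ {d} → d Q.≈ right A a b →
              ThinSemilatticeEdge A (proj₁ c) (proj₁ c ·ᴬ proj₁ d)
  thin-c-c· {d} d≈b with IsFixedOperation.SLS fixed i (proj₁ c) (proj₁ d)
  ... | inj₁ cd≈c =
    contradiction (sym (trans (proj₁-eval₂ A θ t c d) cd≈c)) (c≉b/θ (c·-in-b/θ d≈b))
  ... | inj₂ thin = thin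

  minimal⇒thin : ∀ d → d Q.≈ right A a b →
                 Minimal A (proj₁ c) (proj₁ d) (restrict A θ c d) →
                 ThinSemilatticeEdge A (proj₁ c) (proj₁ d)
  minimal⇒thin d d≈b minimal =
    -- Minimality places `d` in the subalgebra generated by `proj₁ c` and `proj₁ cd′`, so the thin
    -- edge is first moved to end at `proj₁ cd′`.
    case thin⇒Sg⊆pair A (smooth i) (thinSemilatticeEdge-respʳ A (sym cd′≈cd) thin)
           (minimal cd′ cd′≈θd) of λ
      { (inj₁ d≈c)   → contradiction (sym d≈c) (c≉b/θ d≈b)
      ; (inj₂ d≈cd′) → thinSemilatticeEdge-respʳ A (sym (trans d≈cd′ cd′≈cd)) thin
      }
    where
    thin = thin-c-c· d≈b

    -- The product is formed anew inside the subalgebra generated by `c` and `d`, since minimality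
    -- ranges over elements of that algebra.
    cd′ = eval₂ (Sg A (proj₁ c) (proj₁ d) / restrict A θ c d) t
            (left A (proj₁ c) (proj₁ d)) (right A (proj₁ c) (proj₁ d))

    cd′≈cd : proj₁ cd′ ≈ (proj₁ c ·ᴬ proj₁ d)
    cd′≈cd = proj₁-eval₂ A (restrict A θ c d) t
               (left A (proj₁ c) (proj₁ d)) (right A (proj₁ c) (proj₁ d))

    cd′≈θd : rel (restrict A θ c d) cd′ (right A (proj₁ c) (proj₁ d))
    cd′≈θd = begin
      Sg-embed A c d cd′
        -- Both sides have `≈`-equal values but different membership proofs; `reflexive-≈` bridges
        -- them, here and in the last step.
        ≈⟨ reflexive-≈ (trans cd′≈cd (sym (proj₁-eval₂ A θ t c d))) ⟩
      c · d        ≈⟨ c·-in-b/θ d≈b ⟩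
      right A a b  ≈⟨ d≈b ⟨
      d            ≈⟨ reflexive-≈ refl ⟩
      Sg-embed A c d (right A (proj₁ c) (proj₁ d)) ∎
      where open SetoidReasoning Q.universe
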